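{- Consider a feasible instance of 2-TSP with Vertex Requisitions (2-TSPVR) with $n\ge 2$ vertices, and let $q=q(\bar G)$ and the numbers $P_j^{k}$ ($j=1,\dots,q$, $k\in\{0,1\}$) and $P^{(k,l)}_{jj'}$ ($1\le j<j'\le q$, $k,l\in\{0,1\}$) be as defined in the context. Let (Q) be the problem of minimizing over $d\in\{0,1\}^{q}$ the function $$\sum_{j=1}^{q-1}\sum_{j'=j+1}^{q}\Big(P^{(0,0)}_{jj'}(1-d_j)(1-d_{j'})+P^{(0,1)}_{jj'}(1-d_j)d_{j'}+P^{(1,0)}_{jj'}d_j(1-d_{j'})+P^{(1,1)}_{jj'}d_jd_{j'}\Big)+\sum_{j=1}^{q}\big(P_j^0(1-d_j)+P_j^1d_j\big).$$ Let (M) be the mixed integer linear program of minimizing $$\sum_{j=1}^{q-1}\big(p_j^{(0)}+p_j^{(1)}\big)+\sum_{j=1}^{q}\big(P_j^0(1-d_j)+P_j^1d_j\big)$$ over $d\in\{0,1\}^q$ and real $p_j^{(0)},p_j^{(1)}\ge 0$, $j=1,\dots,q-1$, subject to, for $j=1,\dots,q-1$, $$p_j^{(0)}\ge\sum_{j'=j+1}^{q}P^{(0,0)}_{jj'}(1-d_j-d_{j'})+\sum_{j'=j+1}^{q}P^{(0,1)}_{jj'}(d_{j'}-d_j),$$ $$p_j^{(1)}\ge\sum_{j'=j+1}^{q}P^{(1,0)}_{jj'}(d_j-d_{j'})+\sum_{j'=j+1}^{q}P^{(1,1)}_{jj'}(d_j+d_{j'}-1).$$ Then (Q) and (M) are equivalent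 formulations of 2-TSPVR: the optimal values of (Q) and (M) are equal; if $(d,p)$ is an optimal solution of (M) then $d$ is an optimal solution of (Q); for every optimal solution $d$ of (Q) there is $p$ such that $(d,p)$ is an optimal solution of (M); and $d$ is an optimal solution of (Q) if and only if $f_d$ is an optimal solution of the 2-TSPVR instance. Moreover, (M) has $q\le\lfloor n/2\rfloor$ Boolean variables, $2q-2$ real variables (when $q\ge 1$) and $O(q)$ constraints.
   Context: 2-TSPVR. An instance consists of a set $X=\{x_1,\dots,x_n\}$ of vertices of a complete digraph with non-negative arc weights $\rho(x,y)$, $x\ne y$, and subsets (requisitions) $X^1,\dots,X^n\subseteq X$ with $1\le |X^i|\le 2$ for all $i$. $F$ is the set of bijections $f:\{1,\dots,n\}\to X$ with $f(i)\in X^i$ for all $i$; the instance is feasible if $F\neq\emptyset$. The cost of $f\in F$ is $\rho(f)=\sum_{i=1}^{n-1}\rho(f(i),f(i+1))+\rho(f(n),f(1))$, to be minimized over $F$. Indices are cyclic ($n+1:=1$). Bipartite graph. Let $X_n=\{1,\dots,n\}$ and let $\bar G=(X_n,X,\bar U)$ be the bipartite graph with edge set $\bar U=\{\{i,x\}: i\in X_n,\ x\in X^i\}$. Feasible solutions $f\in F$ correspond one-to-one to perfect matchings $\{\{i,f(i)\}: i\in X_n\}$ of $\bar G$. An edge is special if it belongs to all perfect matchings of $\bar G$; a vertex is special if it is incident with a special edge. For a feasible instance, let $\bar G'$ be the graph obtained from $\bar G$ by deleting all special vertices; $\bar G'$ is 2-regular, so its components are even cycles, numbered $1,\dots,q(\bar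 G)$. Each cycle $j$ has exactly two perfect matchings, denoted $w^{0,j}$ and $w^{1,j}$. Each vector $d\in\{0,1\}^{q(\bar G)}$ determines the feasible solution $f_d$ whose perfect matching consists of all special edges and the matchings $w^{d_j,j}$, $j=1,\dots,q(\bar G)$; $d\mapsto f_d$ is a bijection from $\{0,1\}^{q(\bar G)}$ onto $F$. Contacts and the numbers $P$. For each $i\in\{1,\dots,n\}$ consider the pair $(i,i+1)$ of vertices of $X_n$ (with $n+1:=1$). It is a contact inside cycle $j$ if both $i$ and $i+1$ lie on cycle $j$; a contact of cycle $j$ to a special edge if one of $i,i+1$ lies on cycle $j$ and the other is special; a contact between cycles $j\ne j'$ if one of $i,i+1$ lies on cycle $j$ and the other on cycle $j'$. The choice of matchings in the cycles containing $i$ and $i+1$ (together with the special edges) determines the vertices $f(i),f(i+1)$ and hence the $i$-th arc $(f(i),f(i+1))$ of the tour. $P_j^{k}$ is the sum of the weights of the arcs determined by all contacts inside cycle $j$ and all contacts of cycle $j$ to special edges when $w^{k,j}$ is chosen in cycle $j$. $P^{(k,l)}_{jj'}$ is the sum of the weights of the arcs determined by all contacts between cycles $j$ and $j'$ when $w^{k,j}$ is chosen in cycle $j$ and $w^{l,j'}$ in cycle $j'$. Empty sums are zero. -}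

module Defs where

open import Level using (Level; _⊔_; 0ℓ) renaming (suc to lsuc)
open import Algebra.Bundles using (CommutativeRing)
open import Relation.Binary.Core using (Rel)
open import Relation.Binary.Structures using (IsTotalOrder)
open import Relation.Binary.PropositionalEquality using (_≡_; _≢_)
open import Relation.Binary.Construct.Closure.ReflexiveTransitive using (Star)
open import Relation.Nullary using (¬_)
open import Relation.Nullary.Decidable using (⌊_⌋)
open import Data.Bool.Base using (Bool; true; false; if_then_else_; _∧_)
open import Data.Empty.Polymorphic using (⊥)
open import Data.Fin.Base using (Fin; zero; suc; toℕ; inject≤; combine)
open import Data.Fin.Properties using (_≟_; _<?_)
open import Data.Fin.Subset using (Subset; _∈_; ∣_∣)
open import Data.List.Base using (List; []; _∷_; concatMap; allFin)
open import Data.List.Relation.Unary.All using (All)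
open import Data.Maybe.Base using (Maybe; just; nothing)
open import Data.Nat.Base as ℕ using (ℕ; suc)
open import Data.Nat.DivMod using (_mod_)
open import Data.Nat.Properties using (m∸n≤m)
open import Data.Product.Base using (∃; _×_; _,_)
open import Data.Sum.Base using (_⊎_; inj₁; inj₂)
open import Data.Unit.Polymorphic using (⊤)
open import Data.Vec.Functional using (foldr)
open import Function.Bundles using (_⇔_)
open import Function.Definitions using (Bijective)
import Algebra.Properties.Semiring.Sum as SemiringSum

-- Linearly ordered fields.  The real numbers form (classically) such a field;
-- nothing about ℝ beyond this structure is needed to state the results.

record OrderedField (c ℓ₁ ℓ₂ : Level) : Set (lsuc (c ⊔ ℓ₁ ⊔ ℓ₂)) where
  field
    commutativeRing : CommutativeRing c ℓ₁
  open CommutativeRing commutativeRing public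
  infix 4 _≤_
  field
    _≤_          : Rel Carrier ℓ₂
    isTotalOrder : IsTotalOrder _≈_ _≤_
    +-monoˡ-≤    : ∀ z {x y} → x ≤ y → x + z ≤ y + z
    *-nonNeg     : ∀ {x y} → 0# ≤ x → 0# ≤ y → 0# ≤ x * y
    1≉0          : ¬ (1# ≈ 0#)
    inverse      : ∀ x → ¬ (x ≈ 0#) → ∃ λ y → x * y ≈ 1#
  open SemiringSum semiring public using (sum)

  0-1 : Bool → Carrier
  0-1 false = 0#
  0-1 true  = 1#

module Optimization {c ℓ₁ ℓ₂} (K : OrderedField c ℓ₁ ℓ₂) where
  open OrderedField K using (Carrier; _≈_; _≤_; _+_; _*_; _-_; 0#; 1#; sum; 0-1)

  record Minimization (s f : Level) : Set (lsuc (s ⊔ f) ⊔ c) where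
    field
      Candidate  : Set s
      IsFeasible : Candidate → Set f
      objective  : Candidate → Carrier

    IsOptimal : Candidate → Set (s ⊔ f ⊔ ℓ₂)
    IsOptimal x = IsFeasible x × (∀ y → IsFeasible y → objective x ≤ objective y)

    IsOptimalValue : Carrier → Set (s ⊔ f ⊔ ℓ₁ ⊔ ℓ₂)
    IsOptimalValue v = ∃ λ x → IsOptimal x × objective x ≈ v

  infixl 6 _⊕_ _⊖_
  infixl 7 _⊙_
  infix  4 _⊵_

  -- Affine expressions in b Boolean and r real variables.
  data Affine (b r : ℕ) : Set c where
    const   : Carrier → Affine b r
    boolVar : Fin b → Affine b r
    realVar : Fin r → Affine b r
    _⊕_ _⊖_ : Affine b r → Affine b r → Affine b r
    _⊙_     : Carrier → Affine b r → Affine b r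

  eval : ∀ {b r} → (Fin b → Bool) → (Fin r → Carrier) → Affine b r → Carrier
  eval d p (const a)   = a
  eval d p (boolVar j) = 0-1 (d j)
  eval d p (realVar j) = p j
  eval d p (e ⊕ e′)    = eval d p e + eval d p e′
  eval d p (e ⊖ e′)    = eval d p e - eval d p e′
  eval d p (a ⊙ e)     = a * eval d p e

  ⨁ : ∀ {b r m} → (Fin m → Affine b r) → Affine b r
  ⨁ = foldr _⊕_ (const 0#)

  data Constraint (b r : ℕ) : Set c where
    _⊵_ : Affine b r → Affine b r → Constraint b r

  Holds : ∀ {b r} → (Fin b → Bool) → (Fin r → Carrier) → Constraint b r → Set ℓ₂
  Holds d p (e ⊵ e′) = eval d p e′ ≤ eval d p e

  record MILP : Set c where
    field
      #Bool #Real : ℕ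
      goal        : Affine #Bool #Real
      constraints : List (Constraint #Bool #Real)

    minimization : Minimization c (c ⊔ ℓ₂)
    minimization = record
      { Candidate  = (Fin #Bool → Bool) × (Fin #Real → Carrier)
      ; IsFeasible = λ (d , p) → All (Holds d p) constraints
      ; objective  = λ (d , p) → eval d p goal
      }

next : ∀ {n} → Fin n → Fin n
next {suc m} i = suc (toℕ i) mod suc m

module TSP {c ℓ₁ ℓ₂} (K : OrderedField c ℓ₁ ℓ₂) where
  open OrderedField K using (Carrier; _≈_; _≤_; _+_; _*_; _-_; 0#; 1#; sum; 0-1)
  open Optimization K

  -- The values ρ x x are meaningless: no tour on n ≥ 2 vertices uses them.
  record Instance (n : ℕ) : Set (c ⊔ ℓ₂) where
    field
      ρ        : Fin n → Fin n → Carrier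
      ρ-nonNeg : ∀ x y → x ≢ y → 0# ≤ ρ x y
      X        : Fin n → Subset n
      X-lower  : ∀ i → 1 ℕ.≤ ∣ X i ∣
      X-upper  : ∀ i → ∣ X i ∣ ℕ.≤ 2

  module _ {n : ℕ} (I : Instance n) where
    open Instance I

    IsTour : (Fin n → Fin n) → Set
    IsTour f = Bijective _≡_ _≡_ f × (∀ i → f i ∈ X i)

    FeasibleInstance : Set
    FeasibleInstance = ∃ IsTour

    TSPVR : Minimization 0ℓ 0ℓ
    TSPVR = record
      { Candidate  = Fin n → Fin n
      ; IsFeasible = IsTour
      ; objective  = λ f → sum (λ i → ρ (f i) (f (next i)))
      }

    -- Vertices of Ḡ: inj₁ i is the position i ∈ Xₙ, inj₂ x the element x ∈ X.
    Vertex : Set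
    Vertex = Fin n ⊎ Fin n

    Adjacent : Vertex → Vertex → Set
    Adjacent (inj₁ i) (inj₂ x) = x ∈ X i
    Adjacent (inj₂ x) (inj₁ i) = x ∈ X i
    Adjacent _        _        = ⊥

    -- m encodes the set of edges {i , m i} with inj₁ i ∈ S; it is a perfect
    -- matching of the subgraph of Ḡ induced by S.  Values of m at other
    -- positions are irrelevant.
    record IsPerfectMatchingOn (S : Vertex → Set) (m : Fin n → Fin n) : Set where
      field
        isEdge   : ∀ i → S (inj₁ i) → m i ∈ X i × S (inj₂ (m i))
        disjoint : ∀ i i′ → S (inj₁ i) → S (inj₁ i′) → m i ≡ m i′ → i ≡ i′
        covers   : ∀ x → S (inj₂ x) → ∃ λ i → S (inj₁ i) × m i ≡ x

    SpecialEdge : Fin n → Fin n → Set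
    SpecialEdge i x =
      x ∈ X i × (∀ m → IsPerfectMatchingOn (λ _ → ⊤) m → m i ≡ x)

    Special : Vertex → Set
    Special (inj₁ i) = ∃ λ x → SpecialEdge i x
    Special (inj₂ x) = ∃ λ i → SpecialEdge i x

    -- Adjacency in Ḡ′.
    Adjacent′ : Vertex → Vertex → Set
    Adjacent′ u v = ¬ Special u × ¬ Special v × Adjacent u v

    -- The choices of notation for Ḡ: a numbering of the components of Ḡ′, and
    -- names w false j = w^{0,j}, w true j = w^{1,j} for the two perfect
    -- matchings of each component.  That there are no further perfect matchings
    -- and that the components are cycles is a consequence, not part of the data.
    record Labelling : Set where
      field
        q               : ℕ
        component       : Vertex → Maybe (Fin q)
        special         : ∀ v → component v ≡ nothing ⇔ Special v
        component-onto  : ∀ j → ∃ λ v → component v ≡ just j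
        connected       : ∀ u v → ¬ Special u → ¬ Special v →
                          component u ≡ component v ⇔ Star Adjacent′ u v
        mate            : Fin n → Fin n
        mate-special    : ∀ i → Special (inj₁ i) → SpecialEdge i (mate i)
        w               : Bool → Fin q → Fin n → Fin n
        w-perfect       : ∀ k j →
                          IsPerfectMatchingOn (λ v → component v ≡ just j) (w k j)
        w-distinct      : ∀ j → ∃ λ i →
                          component (inj₁ i) ≡ just j × w false j i ≢ w true j i

    module Formulations (L : Labelling) where
      open Labelling L

      tour : (Fin q → Bool) → Fin n → Fin n
      tour d i with component (inj₁ i)
      ... | nothing = mate i
      ... | just j  = w (d j) j i

      is : Fin q → Fin q → Bool
      is j j′ = ⌊ j ≟ j′ ⌋

      -- Contribution of the contact (i , i′) to P_j^k; a and b are the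
      -- components of i and i′ (nothing meaning special).
      ownArc : Fin q → Bool → Fin n → Fin n → Maybe (Fin q) → Maybe (Fin q) → Carrier
      ownArc j k i i′ (just a) (just b) =
        if is a j ∧ is b j then ρ (w k j i) (w k j i′) else 0#
      ownArc j k i i′ (just a) nothing  =
        if is a j then ρ (w k j i) (mate i′) else 0#
      ownArc j k i i′ nothing  (just b) =
        if is b j then ρ (mate i) (w k j i′) else 0#
      ownArc j k i i′ nothing  nothing  = 0#

      -- Contribution of the contact (i , i′) to P_jj′^(k,l), for j ≢ j′.
      crossArc : Fin q → Fin q → Bool → Bool → Fin n → Fin n →
                 Maybe (Fin q) → Maybe (Fin q) → Carrier
      crossArc j j′ k l i i′ (just a) (just b) =
        if is a j ∧ is b j′ then ρ (w k j i) (w l j′ i′) else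
        if is a j′ ∧ is b j then ρ (w l j′ i) (w k j i′) else 0#
      crossArc j j′ k l i i′ _        _        = 0#

      P₁ : Fin q → Bool → Carrier
      P₁ j k = sum λ i →
        ownArc j k i (next i) (component (inj₁ i)) (component (inj₁ (next i)))

      P₂ : Fin q → Fin q → Bool → Bool → Carrier
      P₂ j j′ k l = sum λ i →
        crossArc j j′ k l i (next i) (component (inj₁ i)) (component (inj₁ (next i)))

      -- The indices 1, …, q-1 among 1, …, q.
      below : Fin (q ℕ.∸ 1) → Fin q
      below j = inject≤ j (m∸n≤m q 1)

      Q : Minimization 0ℓ 0ℓ
      Q = record
        { Candidate  = Fin q → Bool
        ; IsFeasible = λ _ → ⊤
        ; objective  = λ d → let δ = λ j → 0-1 (d j) in
            sum (λ j₀ → let j = below j₀ in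
              sum λ j′ → if ⌊ j <? j′ ⌋
                then P₂ j j′ false false * (1# - δ j) * (1# - δ j′)
                   + P₂ j j′ false true  * (1# - δ j) * δ j′
                   + P₂ j j′ true  false * δ j        * (1# - δ j′)
                   + P₂ j j′ true  true  * δ j        * δ j′
                else 0#)
            + sum (λ j → P₁ j false * (1# - δ j) + P₁ j true * δ j)
        }

      M : MILP
      M = record
        { #Bool       = q
        ; #Real       = 2 ℕ.* (q ℕ.∸ 1)
        ; goal        = ⨁ (λ j₀ → p⁰ j₀ ⊕ p¹ j₀)
                      ⊕ ⨁ (λ j → P₁ j false ⊙ (one ⊖ d j) ⊕ P₁ j true ⊙ d j)
        ; constraints = concatMap
            (λ j₀ → let j = below j₀ in
                (p⁰ j₀ ⊵ const 0#)
              ∷ (p¹ j₀ ⊵ const 0#)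
              ∷ (p⁰ j₀ ⊵ ⨁above j (λ j′ → P₂ j j′ false false ⊙ (one ⊖ d j ⊖ d j′))
                       ⊕ ⨁above j (λ j′ → P₂ j j′ false true ⊙ (d j′ ⊖ d j)))
              ∷ (p¹ j₀ ⊵ ⨁above j (λ j′ → P₂ j j′ true false ⊙ (d j ⊖ d j′))
                       ⊕ ⨁above j (λ j′ → P₂ j j′ true true ⊙ (d j ⊕ d j′ ⊖ one)))
              ∷ [])
            (allFin (q ℕ.∸ 1))
        }
        where
        Expr : Set c
        Expr = Affine q (2 ℕ.* (q ℕ.∸ 1))

        one : Expr
        one = const 1#

        d : Fin q → Expr
        d = boolVar

        p⁰ p¹ : Fin (q ℕ.∸ 1) → Expr
        p⁰ j = realVar (combine {2} zero j)
        p¹ j = realVar (combine {2} (suc zero) j)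

        ⨁above : Fin q → (Fin q → Expr) → Expr
        ⨁above j e = ⨁ λ j′ → if ⌊ j <? j′ ⌋ then e j′ else const 0#

{-# OPTIONS --safe #-}
module Submission where

-- A perfect matching that agrees with w^{k,j} at one position of a component j agrees
-- with it on all of j, because every vertex of j has exactly the two edges
-- given by w^{0,j} and w^{1,j}; so the tours are exactly the f_d.  Grouping the arcs
-- of f_d by contacts gives ρ(f_d) = Q(d) + C with C independent of d.  In (M), P ≥ 0
-- makes the right-hand side of the inequality for p_j^{(k)} nonpositive when
-- d_j ≠ k, and for d_j = k it is the sum of the P_jj′^{(d_j,d_j′)} over j′ > j.
-- Hence every feasible (d , p) costs at least Q(d), with equality for a suitable p.

open import Defs
import Algebra.Properties.Semiring.Sum as SemiringSum
open import Data.Bool.Base using (Bool; true; false; not; if_then_else_)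
open import Data.Fin.Base using (Fin; zero; suc; inject≤; inject₁; fromℕ; combine; remQuot;
  splitAt; join; punchOut; _<_)
open import Data.Fin.Properties using (_≟_; _<?_; any?; punchOut-injective; injective⇒≤;
  remQuot-combine; join-splitAt; toℕ-inject₁; toℕ-inject≤; toℕ-injective; <-cmp; <-irrefl; <-asym; ≤fromℕ)
open import Data.Fin.Subset using (Subset; _∈_; ∣_∣) renaming (_-_ to _∖_)
open import Data.Fin.Subset.Properties using (x∈p⇒∣p-x∣<∣p∣; x∈p∧x≢y⇒x∈p-y)
open import Data.List.Base using (List; []; _∷_; length; concatMap; allFin)
open import Data.List.Relation.Unary.All using (All; []; _∷_)
open import Data.List.Relation.Unary.All.Properties using (concat⁺; concat⁻; map⁺; map⁻; tabulate⁺; tabulate⁻)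
open import Data.List.Properties using (length-++; length-tabulate)
open import Data.Maybe.Base using (Maybe; just; nothing; maybe)
open import Data.Maybe.Properties using (just-injective; ≡-dec)
open import Data.Nat.Base as ℕ using (ℕ; zero; suc; _≤_; _*_; _∸_; ⌊_/2⌋; z≤n; s≤s)
import Data.Nat.Properties as ℕₚ
open import Data.Product.Base using (∃; _×_; _,_; proj₁; proj₂)
open import Data.Sum.Base using (_⊎_; inj₁; inj₂; [_,_]′)
open import Data.Unit.Polymorphic using (⊤; tt)
import Data.Vec.Functional as Vector
open import Function.Base using (_∘_; id)
open import Function.Bundles using (_⇔_; mk⇔; Equivalence)
open import Function.Definitions using (Injective; Bijective)
open import Relation.Binary.Bundles using (Poset)
open import Relation.Binary.Construct.Closure.ReflexiveTransitive using (Star; ε; _◅_)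
open import Relation.Binary.Definitions using (tri<; tri≈; tri>)
open import Relation.Binary.PropositionalEquality as ≡ using (_≡_; _≢_; refl; cong; cong₂; subst)
open import Relation.Binary.Structures using (IsTotalOrder)
open import Relation.Nullary using (¬_; yes; no; contradiction)
open import Relation.Nullary.Decidable using (⌊_⌋; _×-dec_; ¬?)
open import Relation.Unary using (Pred; Decidable)

-- Finite sets

-- A `Labelling` promises a single position per component at which the two matchings differ, so that
-- each vertex of a component has exactly their two edges must be derived from the definition of
-- special edges. The obstacle is a position where the matchings agree. If its second edge led into
-- the part where they differ, no perfect matching could use that edge, because the positions of
-- that part already fill their own images; this is a counting fact about finite sets. Its first
-- edge would then be special, yet components contain no special vertex. Connectedness finally
-- carries the difference over the whole component. The constant C of the overview is the total
-- weight of the arcs joining two special positions. Since weights are nonnegative only between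
-- distinct elements, P ≥ 0 also depends on different cycles having disjoint images.

injective⇒surjective : ∀ {n} (f : Fin n → Fin n) → Injective _≡_ _≡_ f → ∀ y → ∃ λ x → f x ≡ y
injective⇒surjective {suc n} f inj y with any? (λ x → f x ≟ y)
... | yes hit = hit
-- Punching out the missed value would inject `Fin (suc n)` into `Fin n`.
... | no miss = contradiction (injective⇒≤ {f = avoid} avoid-injective) ℕₚ.1+n≰n
  where
  y≢f : ∀ x → y ≢ f x
  y≢f x y≡fx = miss (x , ≡.sym y≡fx)

  avoid : Fin (suc n) → Fin n
  avoid x = punchOut (y≢f x)

  avoid-injective : Injective _≡_ _≡_ avoid
  avoid-injective eq = inj (punchOut-injective (y≢f _) (y≢f _) eq)

injective⇒bijective : ∀ {n} (f : Fin n → Fin n) → Injective _≡_ _≡_ f → Bijective _≡_ _≡_ f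
injective⇒bijective f inj = inj , λ y →
  let x , fx≡y = injective⇒surjective f inj y in x , λ { refl → fx≡y }

∣p∣≤2⇒∈-pair : ∀ {n} {p : Subset n} {x y z} → ∣ p ∣ ≤ 2 →
               x ∈ p → y ∈ p → x ≢ y → z ∈ p → z ≡ x ⊎ z ≡ y
∣p∣≤2⇒∈-pair {p = p} {x} {y} {z} p≤2 x∈p y∈p x≢y z∈p with z ≟ x | z ≟ y
... | yes z≡x | _       = inj₁ z≡x
... | no _    | yes z≡y = inj₂ z≡y
... | no z≢x  | no z≢y  = contradiction three≤2 λ { (s≤s (s≤s ())) }
  where
  y∈p-x = x∈p∧x≢y⇒x∈p-y {p = p} y∈p (x≢y ∘ ≡.sym)
  z∈p-x-y = x∈p∧x≢y⇒x∈p-y {p = p ∖ x} (x∈p∧x≢y⇒x∈p-y {p = p} z∈p z≢x) z≢y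

  -- Removing x and then y lowers the cardinality each time, and z still remains.
  three≤2 : 3 ≤ 2
  three≤2 = ℕₚ.≤-trans
    (s≤s (ℕₚ.≤-trans (s≤s (ℕₚ.≤-trans (s≤s z≤n) (x∈p⇒∣p-x∣<∣p∣ z∈p-x-y))) (x∈p⇒∣p-x∣<∣p∣ y∈p-x)))
    (ℕₚ.≤-trans (x∈p⇒∣p-x∣<∣p∣ x∈p) p≤2)

-- u⁻¹ ∘ m on P, extended by the identity, is an injection of Fin n, hence onto.
image-rigid : ∀ {n p} {P : Pred (Fin n) p} → Decidable P → (u m : Fin n → Fin n) →
              Injective _≡_ _≡_ m →
              (∀ i → P i → ∃ λ i′ → P i′ × m i ≡ u i′) →
              ∀ i → P i → ∃ λ i′ → P i′ × m i′ ≡ u i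
image-rigid {n} {P = P} P? u m inj into i Pi = goal
  where
  g : Fin n → Fin n
  g a with P? a
  ... | yes Pa = proj₁ (into a Pa)
  ... | no _   = a

  g-injective : Injective _≡_ _≡_ g
  g-injective {a} {b} eq with P? a | P? b
  -- Since m a = u (g a) on P, equal values of `g` give equal values of `m`. The mixed cases fail
  -- because `g` sends P into P and fixes everything else.
  ... | yes Pa | yes Pb =
        inj (≡.trans (proj₂ (proj₂ (into a Pa)))
            (≡.trans (cong u eq) (≡.sym (proj₂ (proj₂ (into b Pb))))))
  ... | yes Pa | no ¬Pb = contradiction (subst P eq (proj₁ (proj₂ (into a Pa)))) ¬Pb
  ... | no ¬Pa | yes Pb = contradiction (subst P (≡.sym eq) (proj₁ (proj₂ (into b Pb)))) ¬Pa
  ... | no _   | no _   = eq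

  goal : ∃ λ i′ → P i′ × m i′ ≡ u i
  goal with injective⇒surjective g g-injective i
  ... | a , ga≡i with P? a
  ...   | yes Pa = a , Pa , ≡.trans (proj₂ (proj₂ (into a Pa))) (cong u ga≡i)
  ...   | no ¬Pa = contradiction (subst P (≡.sym ga≡i) Pi) ¬Pa

-- Perfect matchings and tours

module Matchings {c ℓ₁ ℓ₂} (K : OrderedField c ℓ₁ ℓ₂) {n : ℕ}
                 (I : TSP.Instance K n) (L : TSP.Labelling K I) where
  open TSP K
  open Instance I
  open Labelling L
  open Formulations I L
  private
    module PM {j k} = IsPerfectMatchingOn (w-perfect k j)

  PerfectMatching : (Fin n → Fin n) → Set
  PerfectMatching = IsPerfectMatchingOn I (λ _ → ⊤)

  tour⇒perfect : ∀ {f} → IsTour I f → PerfectMatching f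
  tour⇒perfect {f} ((inj , sur) , f∈X) = record
    { isEdge   = λ i _ → f∈X i , tt
    ; disjoint = λ _ _ _ _ → inj
    ; covers   = λ x _ → let i , fi≡x = sur x in i , tt , fi≡x refl
    }

  InCycle : Fin q → Fin n → Set
  InCycle j i = component (inj₁ i) ≡ just j

  just⇒¬special : ∀ {v j} → component v ≡ just j → ¬ Special I v
  just⇒¬special {v} v∈j s with ≡.trans (≡.sym v∈j) (Equivalence.from (special v) s)
  ... | ()

  same-cycle : ∀ {u v j} → component u ≡ just j → component v ≡ just j → Star (Adjacent′ I) u v
  same-cycle {u} {v} u∈j v∈j =
    Equivalence.to (connected u v (just⇒¬special u∈j) (just⇒¬special v∈j))
      (≡.trans u∈j (≡.sym v∈j))

  adjacent⇒same : ∀ {u v j} → Adjacent′ I u v → component u ≡ just j → component v ≡ just j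
  adjacent⇒same {u} {v} adj@(¬su , ¬sv , _) u∈j =
    ≡.trans (≡.sym (Equivalence.from (connected u v ¬su ¬sv) (adj ◅ ε))) u∈j

  InCycle-w : ∀ {j i} k → InCycle j i → component (inj₂ (w k j i)) ≡ just j
  InCycle-w k i∈j = proj₂ (PM.isEdge {k = k} _ i∈j)

  -- An auxiliary notion: `w-differ` shows that these positions exhaust the cycle. It is decidable,
  -- as `image-rigid` requires.
  Moving : Fin q → Fin n → Set
  Moving j i = InCycle j i × w false j i ≢ w true j i

  moving? : ∀ j → Decidable (Moving j)
  moving? j i = ≡-dec _≟_ (component (inj₁ i)) (just j) ×-dec ¬? (w false j i ≟ w true j i)

  moving-pair : ∀ {j i x} → Moving j i → x ∈ X i → x ≡ w false j i ⊎ x ≡ w true j i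
  moving-pair (i∈j , w≢) = ∣p∣≤2⇒∈-pair (X-upper _)
    (proj₁ (PM.isEdge {k = false} _ i∈j)) (proj₁ (PM.isEdge {k = true} _ i∈j)) w≢

  -- One step of an alternating path: if x is the `w true` partner of i, the position that `w false`
  -- matches to x moves too, since otherwise `w true` would match both positions to x. This is a
  -- sweeping step for `w-differ` and also the hypothesis of `image-rigid` for an arbitrary perfect
  -- matching.
  moving-neighbour : ∀ {j i x} → Moving j i → x ∈ X i → ∃ λ i′ → Moving j i′ × x ≡ w false j i′
  moving-neighbour {j} {i} {x} mov@(i∈j , w≢) x∈Xi with moving-pair mov x∈Xi
  ... | inj₁ x≡w⁰ = i , mov , x≡w⁰
  ... | inj₂ refl with PM.covers {k = false} _ (InCycle-w true i∈j)
  ...   | i′ , i′∈j , w⁰i′≡x = i′ , (i′∈j , w′≢) , ≡.sym w⁰i′≡x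
    where
    w′≢ : w false j i′ ≢ w true j i′
    w′≢ eq with PM.disjoint {k = true} i i′ i∈j i′∈j (≡.trans (≡.sym w⁰i′≡x) eq)
    ... | refl = w≢ eq

  -- Every perfect matching m maps the moving positions onto their w-images, so a
  -- position outside that is adjacent to such an image cannot use this edge: its
  -- other edge would be special.
  moving-closed : ∀ {j i i′} → Moving j i → InCycle j i′ → w false j i ∈ X i′ → Moving j i′
  moving-closed {j} {i} {i′} mov i′∈j x∈Xi′ with moving? j i′
  ... | yes mov′ = mov′
  ... | no ¬mov′ = contradiction (y , y∈Xi′ , forced) (just⇒¬special i′∈j)
    where
    x = w false j i
    y = w false j i′
    y∈Xi′ : y ∈ X i′
    y∈Xi′ = proj₁ (PM.isEdge i′ i′∈j)

    y≢x : y ≢ x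
    y≢x y≡x = ¬mov′ (subst (Moving j) (≡.sym (PM.disjoint i′ i i′∈j (proj₁ mov) y≡x)) mov)

    forced : ∀ m → PerfectMatching m → m i′ ≡ y
    forced m pm with ∣p∣≤2⇒∈-pair (X-upper i′) y∈Xi′ x∈Xi′ y≢x (proj₁ (IsPerfectMatchingOn.isEdge pm i′ tt))
    ... | inj₁ mi′≡y = mi′≡y
    ... | inj₂ mi′≡x with image-rigid (moving? j) (w false j) m
                            (IsPerfectMatchingOn.disjoint pm _ _ tt tt)
                            (λ a mova → moving-neighbour mova (proj₁ (IsPerfectMatchingOn.isEdge pm a tt)))
                            i mov
    ...   | a , mova , ma≡x = contradiction
              (subst (Moving j) (IsPerfectMatchingOn.disjoint pm a i′ tt tt (≡.trans ma≡x (≡.sym mi′≡x))) mova)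
              ¬mov′

  -- The one position given by `w-distinct` reaches i along a path of Ḡ′. The invariant on the path
  -- is to be a moving position or the `w false` image of one.
  w-differ : ∀ {j i} → InCycle j i → w false j i ≢ w true j i
  w-differ {j} i∈j =
    let i₀ , i₀∈j , w≢ = w-distinct j
    in proj₂ (propagate (same-cycle i₀∈j i∈j) (i₀∈j , w≢))
    where
    Swept : Vertex I → Set
    Swept (inj₁ i) = Moving j i
    Swept (inj₂ x) = ∃ λ i → Moving j i × x ≡ w false j i

    sweep : ∀ {u v} → Adjacent′ I u v → Swept u → Swept v
    sweep {inj₁ _} {inj₂ _} (_ , _ , x∈Xi) mov = moving-neighbour mov x∈Xi
    sweep {inj₂ _} {inj₁ _} adj@(_ , _ , x∈Xi) (i , mov , refl) =
      moving-closed mov (adjacent⇒same adj (InCycle-w false (proj₁ mov))) x∈Xi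
    sweep {inj₁ _} {inj₁ _} (_ , _ , ()) _
    sweep {inj₂ _} {inj₂ _} (_ , _ , ()) _

    propagate : ∀ {u v} → Star (Adjacent′ I) u v → Swept u → Swept v
    propagate ε        s = s
    propagate (a ◅ as) s = propagate as (sweep a s)

  -- This is the 2-regularity of Ḡ′ at positions, in the form used below.
  cycle-pair : ∀ {j i x} k → InCycle j i → x ∈ X i → x ≡ w k j i ⊎ x ≡ w (not k) j i
  cycle-pair false i∈j x∈Xi = moving-pair (i∈j , w-differ i∈j) x∈Xi
  cycle-pair true  i∈j x∈Xi with moving-pair (i∈j , w-differ i∈j) x∈Xi
  ... | inj₁ e = inj₂ e
  ... | inj₂ e = inj₁ e

  w-not≢ : ∀ {j i} k → InCycle j i → w k j i ≢ w (not k) j i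
  w-not≢ false i∈j   = w-differ i∈j
  w-not≢ true  i∈j e = w-differ i∈j (≡.sym e)

  -- A special edge at i would have to be the edge of `f` there, which would make `f i` special. So
  -- the edge survives in Ḡ′ and its ends share a component.
  matched-in-cycle : ∀ {f i j} → PerfectMatching f → component (inj₂ (f i)) ≡ just j → InCycle j i
  matched-in-cycle {f} {i} pm x∈j = adjacent⇒same
    (just⇒¬special x∈j , ¬special , proj₁ (IsPerfectMatchingOn.isEdge pm i tt)) x∈j
    where
    ¬special : ¬ Special I (inj₁ i)
    ¬special (y , e) = just⇒¬special x∈j
      (i , subst (SpecialEdge I i) (≡.sym (proj₂ e f pm)) e)

  matching-on-cycle : ∀ {f j i₀} → PerfectMatching f → InCycle j i₀ → ∀ k → f i₀ ≡ w k j i₀ →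
                      ∀ {i} → InCycle j i → f i ≡ w k j i
  matching-on-cycle {f} {j} pm i₀∈j k fi₀≡ i∈j =
    proj₂ (propagate (same-cycle i₀∈j i∈j) (i₀∈j , fi₀≡))
    where
    module F = IsPerfectMatchingOn pm

    Agrees : Vertex I → Set
    Agrees (inj₁ i) = InCycle j i × f i ≡ w k j i
    Agrees (inj₂ x) = ∃ λ i → InCycle j i × f i ≡ x × w k j i ≡ x

    step : ∀ {u v} → Adjacent′ I u v → Agrees u → Agrees v
    step {inj₁ i} {inj₂ x} adj@(_ , _ , x∈Xi) (i∈j , fi≡) with cycle-pair k i∈j x∈Xi
    ... | inj₁ refl = i , i∈j , fi≡ , refl
    -- Here x is the partner of i in the other matching. Let `f` match x to i′. If `f` followed the
    -- other matching at i′, that matching would force i′ = i, where `f` follows `w k`.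
    ... | inj₂ x≡ with F.covers x tt
    ...   | i′ , _ , refl with matched-in-cycle pm (adjacent⇒same adj i∈j)
    ...     | i′∈j with cycle-pair k i′∈j (proj₁ (F.isEdge i′ tt))
    ...       | inj₁ e = i′ , i′∈j , refl , ≡.sym e
    ...       | inj₂ e with PM.disjoint {k = not k} i′ i i′∈j i∈j (≡.trans (≡.sym e) x≡)
    ...         | refl = contradiction (≡.trans (≡.sym fi≡) x≡) (w-not≢ k i∈j)
    step {inj₂ x} {inj₁ i′} adj@(_ , _ , x∈Xi′) (i , i∈j , fi≡x , wi≡x) = i′∈j , agree
      where
      i′∈j : InCycle j i′
      i′∈j = adjacent⇒same adj (subst (λ y → component (inj₂ y) ≡ just j) wi≡x (InCycle-w k i∈j))

      at : i ≡ i′ → f i′ ≡ w k j i′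
      at refl = ≡.trans fi≡x (≡.sym wi≡x)

      agree : f i′ ≡ w k j i′
      agree with cycle-pair k i′∈j x∈Xi′ | cycle-pair k i′∈j (proj₁ (F.isEdge i′ tt))
      ... | _       | inj₁ e = e
      -- In both remaining cases i = i′: injectivity of `w k` gives it in this one, injectivity of
      -- `f` in the next. Agreement at i then transfers.
      ... | inj₁ x≡ | inj₂ _ = at (PM.disjoint {k = k} i i′ i∈j i′∈j (≡.trans wi≡x x≡))
      ... | inj₂ x≡ | inj₂ e = at (F.disjoint i i′ tt tt (≡.trans fi≡x (≡.trans x≡ (≡.sym e))))
    step {inj₁ _} {inj₁ _} (_ , _ , ()) _
    step {inj₂ _} {inj₂ _} (_ , _ , ()) _

    propagate : ∀ {u v} → Star (Adjacent′ I) u v → Agrees u → Agrees v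
    propagate ε        s = s
    propagate (a ◅ as) s = propagate as (step a s)

  -- This is `tour` with the component as an explicit argument, so that proofs can split on it and
  -- keep the equation that identifies it.
  choose : (Fin q → Bool) → Fin n → Maybe (Fin q) → Fin n
  choose d i = maybe (λ j → w (d j) j i) (mate i)

  tour≡choose : ∀ d i → tour d i ≡ choose d i (component (inj₁ i))
  tour≡choose d i with component (inj₁ i)
  ... | nothing = refl
  ... | just _  = refl

  -- Images remember the component of their position, so a collision in `tour d` can only happen
  -- within one component or among special positions.
  choose-in : ∀ d i a → component (inj₁ i) ≡ a → component (inj₂ (choose d i a)) ≡ a
  choose-in d i nothing  i∉ = Equivalence.from (special _)
    (i , mate-special i (Equivalence.to (special _) i∉))
  choose-in d i (just j) i∈j = InCycle-w (d j) i∈j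

  mate≡ : ∀ {f} → PerfectMatching f → ∀ i → component (inj₁ i) ≡ nothing → f i ≡ mate i
  mate≡ pm i i∉ = proj₂ (mate-special i (Equivalence.to (special _) i∉)) _ pm

  module _ {f₀ : Fin n → Fin n} (f₀-tour : IsTour I f₀) where

    -- On special positions `mate` agrees with the given tour `f₀` and inherits its injectivity.
    -- Feasibility matters here: without a perfect matching every edge would be special vacuously.
    choose-injective : ∀ d i i′ a → component (inj₁ i) ≡ a → component (inj₁ i′) ≡ a →
                       choose d i a ≡ choose d i′ a → i ≡ i′
    choose-injective d i i′ nothing i∉ i′∉ eq = proj₁ (proj₁ f₀-tour)
      (≡.trans (mate≡ pm₀ i i∉) (≡.trans eq (≡.sym (mate≡ pm₀ i′ i′∉))))
      where pm₀ = tour⇒perfect f₀-tour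
    choose-injective d i i′ (just j) i∈j i′∈j eq = PM.disjoint {k = d j} i i′ i∈j i′∈j eq

    choose∈X : ∀ d i a → component (inj₁ i) ≡ a → choose d i a ∈ X i
    choose∈X d i nothing  i∉  = proj₁ (mate-special i (Equivalence.to (special _) i∉))
    choose∈X d i (just j) i∈j = proj₁ (PM.isEdge {k = d j} i i∈j)

    isTour : ∀ d → IsTour I (tour d)
    isTour d = injective⇒bijective (tour d) inj ,
               λ i → subst (_∈ X i) (≡.sym (tour≡choose d i)) (choose∈X d i _ refl)
      where
      inj : Injective _≡_ _≡_ (tour d)
      inj {i} {i′} eq = choose-injective d i i′ _ refl same
        (≡.trans eq′ (cong (choose d i′) same))
        where
        eq′ : choose d i (component (inj₁ i)) ≡ choose d i′ (component (inj₁ i′))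
        eq′ = ≡.trans (≡.sym (tour≡choose d i)) (≡.trans eq (tour≡choose d i′))

        same : component (inj₁ i′) ≡ component (inj₁ i)
        same = ≡.trans (≡.sym (choose-in d i′ _ refl))
              (≡.trans (cong (component ∘ inj₂) (≡.sym eq′)) (choose-in d i _ refl))

  tour-complete : ∀ {f} → IsTour I f → ∃ λ d → ∀ i → f i ≡ tour d i
  tour-complete {f} f-tour = d , λ i → ≡.trans (agree i _ refl) (≡.sym (tour≡choose d i))
    where
    pm = tour⇒perfect f-tour

    choice : ∀ j → ∃ λ k → ∀ {i} → InCycle j i → f i ≡ w k j i
    choice j with w-distinct j
    ... | i₀ , i₀∈j , _ with cycle-pair false i₀∈j (proj₂ f-tour i₀)
    ...   | inj₁ e = false , matching-on-cycle pm i₀∈j false e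
    ...   | inj₂ e = true  , matching-on-cycle pm i₀∈j true e

    d : Fin q → Bool
    d = proj₁ ∘ choice

    agree : ∀ i a → component (inj₁ i) ≡ a → f i ≡ choose d i a
    agree i nothing  i∉  = mate≡ pm i i∉
    agree i (just j) i∈j = proj₂ (choice j) i∈j

  -- This supplies the distinctness demanded by `ρ-nonNeg` for arcs of contacts between two cycles.
  w-separate : ∀ {j j′ i i′} k l → InCycle j i → InCycle j′ i′ → j ≢ j′ → w k j i ≢ w l j′ i′
  w-separate k l i∈j i′∈j′ j≢j′ eq = j≢j′ (just-injective
    (≡.trans (≡.sym (InCycle-w k i∈j))
    (≡.trans (cong (component ∘ inj₂) eq) (InCycle-w l i′∈j′))))

  -- Each cycle contributes two positions: one where the matchings differ, and the one that `w true`
  -- matches to the `w false` partner of the first. They coincide only if the matchings agree there,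
  -- so `Fin (q + q)` injects into `Fin n`.
  q≤⌊n/2⌋ : q ≤ ⌊ n /2⌋
  q≤⌊n/2⌋ = subst (_≤ ⌊ n /2⌋) (≡.sym (ℕₚ.n≡⌊n+n/2⌋ q))
    (ℕₚ.⌊n/2⌋-mono (injective⇒≤ {f = position ∘ splitAt q} injective))
    where
    partner : ∀ j → let i = proj₁ (w-distinct j) in
              ∃ λ i′ → InCycle j i′ × w true j i′ ≡ w false j i
    partner j = let i , i∈j , _ = w-distinct j in PM.covers {k = true} _ (InCycle-w false i∈j)

    position : Fin q ⊎ Fin q → Fin n
    position (inj₁ j) = proj₁ (w-distinct j)
    position (inj₂ j) = proj₁ (partner j)

    first∈ : ∀ j → InCycle j (position (inj₁ j))
    first∈ j = proj₁ (proj₂ (w-distinct j))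

    second∈ : ∀ j → InCycle j (position (inj₂ j))
    second∈ j = proj₁ (proj₂ (partner j))

    cycle-unique : ∀ {j j′ i i′} → InCycle j i → InCycle j′ i′ → i ≡ i′ → j ≡ j′
    cycle-unique i∈j i′∈j′ refl = just-injective (≡.trans (≡.sym i∈j) i′∈j′)

    first≢second : ∀ j j′ → position (inj₁ j) ≢ position (inj₂ j′)
    first≢second j j′ eq with cycle-unique (first∈ j) (second∈ j′) eq
    ... | refl = proj₂ (proj₂ (w-distinct j))
      (≡.trans (≡.sym (proj₂ (proj₂ (partner j)))) (cong (w true j) (≡.sym eq)))

    position-injective : ∀ a b → position a ≡ position b → a ≡ b
    position-injective (inj₁ j) (inj₁ j′) eq = cong inj₁ (cycle-unique (first∈ j) (first∈ j′) eq)
    position-injective (inj₂ j) (inj₂ j′) eq = cong inj₂ (cycle-unique (second∈ j) (second∈ j′) eq)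
    position-injective (inj₁ j) (inj₂ j′) eq = contradiction eq (first≢second j j′)
    position-injective (inj₂ j) (inj₁ j′) eq = contradiction (≡.sym eq) (first≢second j′ j)

    injective : Injective _≡_ _≡_ (position ∘ splitAt q)
    injective {x} {y} eq = ≡.trans (≡.sym (join-splitAt q q x))
      (≡.trans (cong (join q q) (position-injective (splitAt q x) (splitAt q y) eq)) (join-splitAt q q y))

-- Sums and order in an ordered field

module OrderedFieldProperties {c ℓ₁ ℓ₂} (K : OrderedField c ℓ₁ ℓ₂) where
  open OrderedField K hiding (_≤_; refl; _*_; zero) renaming (sym to ≈-sym; trans to ≈-trans)
  open OrderedField K public using () renaming (_≤_ to _≤ᴷ_; _*_ to _·_)
  open IsTotalOrder isTotalOrder public using ()
    renaming (refl to ≤-refl; reflexive to ≤-reflexive; trans to ≤-trans; total to ≤-total)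
  open IsTotalOrder isTotalOrder using (isPartialOrder)
  open SemiringSum semiring public using (sum-cong-≋; ∑-distrib-+; ∑-comm; sum-init-last)
  open import Algebra.Properties.Ring ring using (-‿distribʳ-*; -0#≈0#)

  ≤-poset : Poset c ℓ₁ ℓ₂
  ≤-poset = record { isPartialOrder = isPartialOrder }

  open import Relation.Binary.Reasoning.PartialOrder ≤-poset

  refl≈ : ∀ {x} → x ≈ x
  refl≈ = OrderedField.refl K

  +-mono-≤ : ∀ {x y u v} → x ≤ᴷ y → u ≤ᴷ v → x + u ≤ᴷ y + v
  +-mono-≤ {x} {y} {u} {v} x≤y u≤v = begin
    x + u  ≤⟨ +-monoˡ-≤ u x≤y ⟩
    y + u  ≈⟨ +-comm y u ⟩
    u + y  ≤⟨ +-monoˡ-≤ y u≤v ⟩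
    v + y  ≈⟨ +-comm v y ⟩
    y + v  ∎

  +-cancelʳ-≤ : ∀ {x y} z → x + z ≤ᴷ y + z → x ≤ᴷ y
  +-cancelʳ-≤ {x} {y} z le = begin
    x              ≈⟨ undo x ⟨
    x + z + (- z)  ≤⟨ +-monoˡ-≤ (- z) le ⟩
    y + z + (- z)  ≈⟨ undo y ⟩
    y              ∎
    where
    undo : ∀ t → t + z + (- z) ≈ t
    undo t = ≈-trans (+-assoc t z (- z)) (≈-trans (+-congˡ (-‿inverseʳ z)) (+-identityʳ t))

  +-nonNeg : ∀ {x y} → 0# ≤ᴷ x → 0# ≤ᴷ y → 0# ≤ᴷ x + y
  +-nonNeg 0≤x 0≤y = ≤-trans (≤-reflexive (≈-sym (+-identityˡ 0#))) (+-mono-≤ 0≤x 0≤y)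

  +-nonPos : ∀ {x y} → x ≤ᴷ 0# → y ≤ᴷ 0# → x + y ≤ᴷ 0#
  +-nonPos x≤0 y≤0 = ≤-trans (+-mono-≤ x≤0 y≤0) (≤-reflexive (+-identityˡ 0#))

  -‿nonPos : ∀ {x} → 0# ≤ᴷ x → - x ≤ᴷ 0#
  -‿nonPos {x} 0≤x = begin
    - x        ≈⟨ +-identityˡ (- x) ⟨
    0# + - x   ≤⟨ +-monoˡ-≤ (- x) 0≤x ⟩
    x + - x    ≈⟨ -‿inverseʳ x ⟩
    0#         ∎

  x-0≈x : ∀ x → x - 0# ≈ x
  x-0≈x x = ≈-trans (+-congˡ -0#≈0#) (+-identityʳ x)

  ·-≈1 : ∀ a {s} → s ≈ 1# → a · s ≈ a
  ·-≈1 a s≈1 = ≈-trans (*-congˡ s≈1) (*-identityʳ a)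

  ·-≈0 : ∀ a {s} → s ≈ 0# → a · s ≈ 0#
  ·-≈0 a s≈0 = ≈-trans (*-congˡ s≈0) (zeroʳ a)

  ·-nonPos : ∀ {a s} → 0# ≤ᴷ a → s ≈ - 1# → a · s ≤ᴷ 0#
  ·-nonPos {a} {s} 0≤a s≈-1 = begin
    a · s       ≈⟨ *-congˡ s≈-1 ⟩
    a · - 1#    ≈⟨ -‿distribʳ-* a 1# ⟨
    - (a · 1#)  ≈⟨ -‿cong (*-identityʳ a) ⟩
    - a         ≤⟨ -‿nonPos 0≤a ⟩
    0#          ∎

  sum-zero : ∀ {n} {g : Fin n → Carrier} → (∀ j → g j ≈ 0#) → sum g ≈ 0#
  sum-zero {zero}  g≈0 = refl≈
  sum-zero {suc n} g≈0 = ≈-trans (+-cong (g≈0 zero) (sum-zero (g≈0 ∘ suc))) (+-identityˡ 0#)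

  sum-pick : ∀ {n} {g : Fin n → Carrier} a → (∀ j → j ≢ a → g j ≈ 0#) → sum g ≈ g a
  sum-pick zero    g≈0 =
    ≈-trans (+-congˡ (sum-zero (λ j → g≈0 (suc j) λ ()))) (+-identityʳ _)
  sum-pick (suc a) g≈0 = ≈-trans
    (+-cong (g≈0 zero λ ()) (sum-pick a (λ j j≢a → g≈0 (suc j) λ { refl → j≢a refl })))
    (+-identityˡ _)

  sum-mono-≤ : ∀ {n} {g h : Fin n → Carrier} → (∀ j → g j ≤ᴷ h j) → sum g ≤ᴷ sum h
  sum-mono-≤ {zero}  g≤h = ≤-refl
  sum-mono-≤ {suc n} g≤h = +-mono-≤ (g≤h zero) (sum-mono-≤ (g≤h ∘ suc))

  sum-nonNeg : ∀ {n} {g : Fin n → Carrier} → (∀ j → 0# ≤ᴷ g j) → 0# ≤ᴷ sum g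
  sum-nonNeg {zero}  0≤g = ≤-refl
  sum-nonNeg {suc n} 0≤g = +-nonNeg (0≤g zero) (sum-nonNeg (0≤g ∘ suc))

  sum-nonPos : ∀ {n} {g : Fin n → Carrier} → (∀ j → g j ≤ᴷ 0#) → sum g ≤ᴷ 0#
  sum-nonPos {zero}  g≤0 = ≤-refl
  sum-nonPos {suc n} g≤0 = +-nonPos (g≤0 zero) (sum-nonPos (g≤0 ∘ suc))

  -- The outer sums of Q and M stop at q-1. The omitted index is the greatest one, where a sum over
  -- larger indices is empty; for q = 0 both sides are empty.
  sum-below : ∀ q (g : Fin q → Carrier) → (∀ j → (∀ (j′ : Fin q) → ¬ j < j′) → g j ≈ 0#) →
              sum (λ j₀ → g (inject≤ j₀ (ℕₚ.m∸n≤m q 1))) ≈ sum g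
  sum-below zero    g _        = refl≈
  sum-below (suc m) g top≈0 = ≈-sym (begin-equality
    sum g                                         ≈⟨ sum-init-last g ⟩
    sum (g ∘ inject₁) + g (fromℕ m)               ≈⟨ +-congˡ (top≈0 (fromℕ m) (λ j′ → ℕₚ.≤⇒≯ (≤fromℕ j′))) ⟩
    sum (g ∘ inject₁) + 0#                        ≈⟨ +-identityʳ _ ⟩
    sum (g ∘ inject₁)                             ≈⟨ sum-cong-≋ (λ j → reflexive (cong g (inject-agree j))) ⟩
    sum (λ j₀ → g (inject≤ j₀ (ℕₚ.m∸n≤m (suc m) 1)))  ∎)
    where
    inject-agree : ∀ j → inject₁ j ≡ inject≤ j (ℕₚ.m∸n≤m (suc m) 1)
    inject-agree j = toℕ-injective (≡.trans (toℕ-inject₁ j) (≡.sym (toℕ-inject≤ j _)))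

  if-sum : ∀ b {n} (g : Fin n → Carrier) →
           (if b then sum g else 0#) ≈ sum (λ i → if b then g i else 0#)
  if-sum true  g = refl≈
  if-sum false {n} g = ≈-sym (sum-zero {n} {λ _ → 0#} (λ _ → refl≈))

  if-+ : ∀ b x y → (if b then x else 0#) + (if b then y else 0#) ≈ (if b then x + y else 0#)
  if-+ true  x y = refl≈
  if-+ false x y = +-identityˡ 0#

  if-cong : ∀ b {x y} → x ≈ y → (if b then x else 0#) ≈ (if b then y else 0#)
  if-cong true  x≈y = x≈y
  if-cong false x≈y = refl≈

  interpolate : ∀ a b y → a · (1# - 0-1 y) + b · 0-1 y ≈ (if y then b else a)
  interpolate a b false = ≈-trans (+-cong (·-≈1 a (x-0≈x 1#)) (zeroʳ b)) (+-identityʳ a)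
  interpolate a b true  = ≈-trans (+-cong (·-≈0 a (-‿inverseʳ 1#)) (*-identityʳ b)) (+-identityˡ b)

  -- Induction on q compares the best vectors with first entry `false` and `true`. The congruence
  -- hypothesis stands in for function extensionality, since a vector is only pointwise equal to its
  -- head consed onto its tail.
  argmin : ∀ q (F : (Fin q → Bool) → Carrier) → (∀ {d e} → (∀ j → d j ≡ e j) → F d ≈ F e) →
           ∃ λ d → ∀ e → F d ≤ᴷ F e
  argmin zero    F F-cong = (λ ()) , λ e → ≤-reflexive (F-cong λ ())
  argmin (suc q) F F-cong with best false | best true
    where
    best : ∀ k → ∃ λ d → ∀ e → F (k Vector.∷ d) ≤ᴷ F (k Vector.∷ e)
    best k = argmin q (F ∘ (k Vector.∷_))
      (λ d≗e → F-cong λ { zero → refl ; (suc j) → d≗e j })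
  ... | d⁰ , min⁰ | d¹ , min¹ = choose (≤-total (F x⁰) (F x¹))
    where
    x⁰ x¹ : Fin (suc q) → Bool
    x⁰ = false Vector.∷ d⁰
    x¹ = true  Vector.∷ d¹

    split : ∀ e → F x⁰ ≤ᴷ F e ⊎ F x¹ ≤ᴷ F e
    split e with e zero in e₀
    ... | false = inj₁ (≤-trans (min⁰ (e ∘ suc)) (≤-reflexive (F-cong λ { zero → ≡.sym e₀ ; (suc j) → refl })))
    ... | true  = inj₂ (≤-trans (min¹ (e ∘ suc)) (≤-reflexive (F-cong λ { zero → ≡.sym e₀ ; (suc j) → refl })))

    choose : F x⁰ ≤ᴷ F x¹ ⊎ F x¹ ≤ᴷ F x⁰ → ∃ λ d → ∀ e → F d ≤ᴷ F e
    choose (inj₁ le) = x⁰ , λ e → [ id , ≤-trans le ]′ (split e)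
    choose (inj₂ le) = x¹ , λ e → [ ≤-trans le , id ]′ (split e)

-- The cost of a tour

module Cost {c ℓ₁ ℓ₂} (K : OrderedField c ℓ₁ ℓ₂) {n : ℕ}
            (I : TSP.Instance K n) (L : TSP.Labelling K I) where
  open OrderedField K hiding (_≤_; refl; _*_; zero) renaming (sym to ≈-sym; trans to ≈-trans)
  open OrderedFieldProperties K
  open Optimization K
  open TSP K
  open Instance I
  open Labelling L
  open Formulations I L
  open Matchings K I L
  open import Relation.Binary.Reasoning.Setoid setoid

  above : Fin q → (Fin q → Carrier) → Carrier
  above j g = sum λ j′ → if ⌊ j <? j′ ⌋ then g j′ else 0#

  above-cong : ∀ j {g h} → (∀ j′ → g j′ ≈ h j′) → above j g ≈ above j h
  above-cong j g≈h = sum-cong-≋ λ j′ → if-cong ⌊ j <? j′ ⌋ (g≈h j′)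

  above-≈0 : ∀ j {g} → (∀ j′ → j < j′ → g j′ ≈ 0#) → above j g ≈ 0#
  above-≈0 j {g} g≈0 = sum-zero vanish
    where
    vanish : ∀ j′ → (if ⌊ j <? j′ ⌋ then g j′ else 0#) ≈ 0#
    vanish j′ with j <? j′
    ... | yes j<j′ = g≈0 j′ j<j′
    ... | no _     = refl≈

  sum-above : (g : Fin q → Fin q → Carrier) →
              sum (λ j₀ → above (below j₀) (g (below j₀))) ≈ sum (λ j → above j (g j))
  sum-above g = sum-below q (λ j → above j (g j))
    λ j top → above-≈0 j λ j′ j<j′ → contradiction j<j′ (top j′)

  above-pick : ∀ {a b g} → a < b → (∀ j′ → j′ ≢ b → g j′ ≈ 0#) → above a g ≈ g b
  above-pick {a} {b} {g} a<b g≈0 = ≈-trans (sum-pick b vanish) hit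
    where
    vanish : ∀ j′ → j′ ≢ b → (if ⌊ a <? j′ ⌋ then g j′ else 0#) ≈ 0#
    vanish j′ j′≢b with a <? j′
    ... | yes _ = g≈0 j′ j′≢b
    ... | no _  = refl≈

    hit : (if ⌊ a <? b ⌋ then g b else 0#) ≈ g b
    hit with a <? b
    ... | yes _  = refl≈
    ... | no a≮b = contradiction a<b a≮b

  cross : (Fin q → Bool) → Fin q → Carrier
  cross d j = above j λ j′ → P₂ j j′ (d j) (d j′)

  -- The objective with the numbers P selected by d directly instead of through polynomials in d.
  -- All three problems are compared with it.
  chosen : (Fin q → Bool) → Carrier
  chosen d = sum (cross d) + sum (λ j → P₁ j (d j))

  cross-cong : ∀ {d e} → (∀ j → d j ≡ e j) → ∀ j → cross d j ≈ cross e j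
  cross-cong d≗e j = above-cong j λ j′ → reflexive (cong₂ (P₂ j j′) (d≗e j) (d≗e j′))

  chosen-cong : ∀ {d e} → (∀ j → d j ≡ e j) → chosen d ≈ chosen e
  chosen-cong d≗e = +-cong (sum-cong-≋ (cross-cong d≗e))
    (sum-cong-≋ λ j → reflexive (cong (P₁ j) (d≗e j)))

  interpolate₂ : ∀ (P : Bool → Bool → Carrier) x y →
      P false false · (1# - 0-1 x) · (1# - 0-1 y)
    + P false true  · (1# - 0-1 x) · 0-1 y
    + P true  false · 0-1 x        · (1# - 0-1 y)
    + P true  true  · 0-1 x        · 0-1 y
    ≈ P x y
  interpolate₂ P x y = begin
    -- The summands are paired by their factor in x. Interpolating each pair in y leaves, for each
    -- value of y, one interpolation in x.
    _                                         ≈⟨ +-assoc _ _ _ ⟩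
    _                                         ≈⟨ +-cong (interpolate _ _ y) (interpolate _ _ y) ⟩
    (if y then P false true · (1# - 0-1 x) else P false false · (1# - 0-1 x))
    + (if y then P true true · 0-1 x else P true false · 0-1 x)
                                              ≈⟨ outer x y ⟩
    P x y                                     ∎
    where
    outer : ∀ x y → (if y then P false true · (1# - 0-1 x) else P false false · (1# - 0-1 x))
                    + (if y then P true true · 0-1 x else P true false · 0-1 x) ≈ P x y
    outer false false = interpolate _ _ false
    outer false true  = interpolate _ _ false
    outer true  false = interpolate _ _ true
    outer true  true  = interpolate _ _ true

  linear≈ : ∀ (d : Fin q → Bool) → sum (λ j → P₁ j false · (1# - 0-1 (d j)) + P₁ j true · 0-1 (d j))
                ≈ sum (λ j → P₁ j (d j))
  linear≈ d = sum-cong-≋ λ j → pick j (d j)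
    where
    pick : ∀ j k → P₁ j false · (1# - 0-1 k) + P₁ j true · 0-1 k ≈ P₁ j k
    pick j false = interpolate _ _ false
    pick j true  = interpolate _ _ true

  Q≈chosen : ∀ d → Minimization.objective Q d ≈ chosen d
  Q≈chosen d = +-cong
    (≈-trans
      (sum-cong-≋ λ j₀ → above-cong (below j₀) λ j′ →
        interpolate₂ (P₂ (below j₀) j′) (d (below j₀)) (d j′))
      (sum-above λ j j′ → P₂ j j′ (d j) (d j′)))
    (linear≈ d)

  -- Contacts between two special positions enter neither `P₁` nor `P₂`; they make up the offset
  -- independent of d.
  fixedArc : Fin n → Fin n → Maybe (Fin q) → Maybe (Fin q) → Carrier
  fixedArc i i′ nothing nothing = ρ (mate i) (mate i′)
  fixedArc i i′ _       _       = 0#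

  fixed : Carrier
  fixed = sum λ i → fixedArc i (next i) (component (inj₁ i)) (component (inj₁ (next i)))

  is-refl : ∀ a → is a a ≡ true
  is-refl a with a ≟ a
  ... | yes _ = refl
  ... | no ¬p = contradiction refl ¬p

  is-≢ : ∀ {a b} → a ≢ b → is a b ≡ false
  is-≢ {a} {b} a≢b with a ≟ b
  ... | yes p = contradiction p a≢b
  ... | no _  = refl

  crossArc-zero : ∀ {j j′ k l i i′ a b} → ¬ (a ≡ j × b ≡ j′) → ¬ (a ≡ j′ × b ≡ j) →
                  crossArc j j′ k l i i′ (just a) (just b) ≡ 0#
  crossArc-zero {j} {j′} {a = a} {b} ¬fwd ¬bwd with a ≟ j | b ≟ j′ | a ≟ j′ | b ≟ j
  ... | yes p | yes r | _     | _     = contradiction (p , r) ¬fwd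
  ... | _     | _     | yes p | yes r = contradiction (p , r) ¬bwd
  ... | yes _ | no _  | yes _ | no _  = refl
  ... | yes _ | no _  | no _  | _     = refl
  ... | no _  | _     | yes _ | no _  = refl
  ... | no _  | _     | no _  | _     = refl

  -- Each arc is counted exactly once: in `fixedArc` if both ends are special, in the `ownArc` of a
  -- single cycle if one cycle is involved, and for two cycles in the `crossArc` of the pair taken
  -- in increasing order.
  contact : ∀ d i i′ a b →
    ρ (choose d i a) (choose d i′ b) ≈
      fixedArc i i′ a b
    + (sum (λ j → above j λ j′ → crossArc j j′ (d j) (d j′) i i′ a b)
      + sum (λ j → ownArc j (d j) i i′ a b))
  contact d i i′ nothing nothing = ≈-sym (≈-trans
    (+-congˡ (≈-trans
      (+-cong (sum-zero λ j → above-≈0 j λ _ _ → refl≈) (sum-zero {q} {λ _ → 0#} λ _ → refl≈)) (+-identityˡ 0#)))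
    (+-identityʳ _))
  contact d i i′ (just a) nothing = ≈-sym (≈-trans (+-identityˡ _) (≈-trans
    (+-cong (sum-zero λ j → above-≈0 j λ _ _ → refl≈) (sum-pick a off)) (≈-trans (+-identityˡ _) on)))
    where
    own = λ j → ownArc j (d j) i i′ (just a) nothing
    off : ∀ j → j ≢ a → own j ≈ 0#
    off j j≢a rewrite is-≢ (j≢a ∘ ≡.sym) = refl≈
    on : own a ≈ ρ (w (d a) a i) (mate i′)
    on rewrite is-refl a = refl≈
  contact d i i′ nothing (just b) = ≈-sym (≈-trans (+-identityˡ _) (≈-trans
    (+-cong (sum-zero λ j → above-≈0 j λ _ _ → refl≈) (sum-pick b off)) (≈-trans (+-identityˡ _) on)))
    where
    own = λ j → ownArc j (d j) i i′ nothing (just b)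
    off : ∀ j → j ≢ b → own j ≈ 0#
    off j j≢b rewrite is-≢ (j≢b ∘ ≡.sym) = refl≈
    on : own b ≈ ρ (mate i) (w (d b) b i′)
    on rewrite is-refl b = refl≈
  contact d i i′ (just a) (just b) = ≈-sym (≈-trans (+-identityˡ _) (split (<-cmp a b)))
    where
    arc = ρ (w (d a) a i) (w (d b) b i′)
    own = λ j → ownArc j (d j) i i′ (just a) (just b)
    pair = λ j j′ → crossArc j j′ (d j) (d j′) i i′ (just a) (just b)

    pair-off : ∀ {j j′} → ¬ (a ≡ j × b ≡ j′) → ¬ (a ≡ j′ × b ≡ j) → pair j j′ ≈ 0#
    pair-off {j} {j′} ¬fwd ¬bwd =
      reflexive (crossArc-zero {j} {j′} {d j} {d j′} {i} {i′} ¬fwd ¬bwd)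

    own-off : a ≢ b → ∀ j → own j ≈ 0#
    own-off a≢b j with a ≟ j | b ≟ j
    ... | yes refl | yes refl = contradiction refl a≢b
    ... | yes _    | no _     = refl≈
    ... | no _     | _        = refl≈

    split : _ → sum (λ j → above j (pair j)) + sum own ≈ arc
    split (tri≈ _ refl _) = ≈-trans
      (+-cong (sum-zero λ j → above-≈0 j λ j′ j<j′ → pair-off
                 (λ { (refl , refl) → <-irrefl refl j<j′ })
                 (λ { (refl , refl) → <-irrefl refl j<j′ }))
              (≈-trans (sum-pick a off) on))
      (+-identityˡ _)
      where
      off : ∀ j → j ≢ a → own j ≈ 0#
      off j j≢a rewrite is-≢ (j≢a ∘ ≡.sym) = refl≈
      on : own a ≈ arc
      on rewrite is-refl a = refl≈
    split (tri< a<b a≢b _) = ≈-trans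
      (+-cong (≈-trans (sum-pick a outer) (≈-trans (above-pick a<b inner) on)) (sum-zero (own-off a≢b)))
      (+-identityʳ _)
      where
      outer : ∀ j → j ≢ a → above j (pair j) ≈ 0#
      outer j j≢a = above-≈0 j λ j′ j<j′ → pair-off
        (λ { (refl , _) → j≢a refl }) (λ { (refl , refl) → <-asym a<b j<j′ })
      inner : ∀ j′ → j′ ≢ b → pair a j′ ≈ 0#
      inner j′ j′≢b = pair-off
        (λ { (_ , refl) → j′≢b refl }) (λ { (_ , b≡a) → a≢b (≡.sym b≡a) })
      on : pair a b ≈ arc
      on rewrite is-refl a | is-refl b = refl≈
    split (tri> _ a≢b b<a) = ≈-trans
      (+-cong (≈-trans (sum-pick b outer) (≈-trans (above-pick b<a inner) on)) (sum-zero (own-off a≢b)))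
      (+-identityʳ _)
      where
      outer : ∀ j → j ≢ b → above j (pair j) ≈ 0#
      outer j j≢b = above-≈0 j λ j′ j<j′ → pair-off
        (λ { (refl , refl) → <-asym b<a j<j′ }) (λ { (_ , refl) → j≢b refl })
      inner : ∀ j′ → j′ ≢ a → pair b j′ ≈ 0#
      inner j′ j′≢a = pair-off
        (λ { (a≡b , _) → a≢b a≡b }) (λ { (refl , _) → j′≢a refl })
      on : pair b a ≈ arc
      -- The arc runs from the larger cycle index to the smaller, so the first test of `crossArc`
      -- must fail before the reversed branch yields it.
      on rewrite is-≢ a≢b | is-refl a | is-refl b = refl≈

  above-sum : ∀ j {m} (g : Fin m → Fin q → Carrier) →
              sum (λ i → above j (g i)) ≈ above j (λ j′ → sum λ i → g i j′)
  above-sum j {m} g = ≈-trans (∑-comm {m} {q} λ i j′ → if ⌊ j <? j′ ⌋ then g i j′ else 0#)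
    (sum-cong-≋ λ j′ → ≈-sym (if-sum ⌊ j <? j′ ⌋ (λ i → g i j′)))

  tourCost : (Fin n → Fin n) → Carrier
  tourCost = Minimization.objective (TSPVR I)

  tourCost-cong : ∀ {f g} → (∀ i → f i ≡ g i) → tourCost f ≈ tourCost g
  tourCost-cong f≗g = sum-cong-≋ λ i → reflexive (cong₂ ρ (f≗g i) (f≗g (next i)))

  -- Summing `contact` over all positions and moving that sum innermost turns the contributions into
  -- `P₁` and `P₂`.
  tourCost≈chosen+fixed : ∀ d → tourCost (tour d) ≈ chosen d + fixed
  tourCost≈chosen+fixed d = begin
    tourCost (tour d)
      ≈⟨ sum-cong-≋ (λ i → ≈-trans
           (reflexive (cong₂ ρ (tour≡choose d i) (tour≡choose d (next i))))
           (contact d i (next i) (component (inj₁ i)) (component (inj₁ (next i))))) ⟩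
    sum (λ i → fixedArcs i + (crossArcs i + ownArcs i))
      ≈⟨ ∑-distrib-+ fixedArcs _ ⟩
    fixed + sum (λ i → crossArcs i + ownArcs i)
      ≈⟨ +-congˡ (∑-distrib-+ crossArcs ownArcs) ⟩
    fixed + (sum crossArcs + sum ownArcs)
      ≈⟨ +-congˡ (+-cong
           (≈-trans (∑-comm λ i j → above j (crossAt i j)) (sum-cong-≋ λ j → above-sum j λ i → crossAt i j))
           (∑-comm ownAt)) ⟩
    fixed + chosen d
      ≈⟨ +-comm _ _ ⟩
    chosen d + fixed ∎
    where
    crossAt : Fin n → Fin q → Fin q → Carrier
    crossAt i j j′ =
      crossArc j j′ (d j) (d j′) i (next i) (component (inj₁ i)) (component (inj₁ (next i)))

    ownAt : Fin n → Fin q → Carrier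
    ownAt i j = ownArc j (d j) i (next i) (component (inj₁ i)) (component (inj₁ (next i)))

    fixedArcs crossArcs ownArcs : Fin n → Carrier
    fixedArcs i = fixedArc i (next i) (component (inj₁ i)) (component (inj₁ (next i)))
    crossArcs i = sum λ j → above j (crossAt i j)
    ownArcs i = sum (ownAt i)

  P₂-nonNeg : ∀ {j j′} k l → j < j′ → 0# ≤ᴷ P₂ j j′ k l
  P₂-nonNeg {j} {j′} k l j<j′ = sum-nonNeg λ i → nonNeg i (next i) _ _ refl refl
    where
    j≢j′ : j ≢ j′
    j≢j′ refl = <-irrefl refl j<j′

    nonNeg : ∀ i i′ a b → component (inj₁ i) ≡ a → component (inj₁ i′) ≡ b →
             0# ≤ᴷ crossArc j j′ k l i i′ a b
    nonNeg i i′ nothing  b        _   _    = ≤-refl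
    nonNeg i i′ (just a) nothing  _   _    = ≤-refl
    nonNeg i i′ (just a) (just b) i∈a i′∈b with a ≟ j | b ≟ j′ | a ≟ j′ | b ≟ j
    ... | yes refl | yes refl | _        | _        = ρ-nonNeg _ _ (w-separate k l i∈a i′∈b j≢j′)
    ... | yes refl | no _     | yes refl | _        = contradiction refl j≢j′
    ... | yes refl | no _     | no _     | _        = ≤-refl
    ... | no _     | _        | yes refl | yes refl = ρ-nonNeg _ _ (w-separate l k i∈a i′∈b (j≢j′ ∘ ≡.sym))
    ... | no _     | _        | yes refl | no _     = ≤-refl
    ... | no _     | _        | no _     | _        = ≤-refl

  cross-nonNeg : ∀ d j → 0# ≤ᴷ cross d j
  cross-nonNeg d j = sum-nonNeg nonNeg
    where
    nonNeg : ∀ j′ → 0# ≤ᴷ (if ⌊ j <? j′ ⌋ then P₂ j j′ (d j) (d j′) else 0#)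
    nonNeg j′ with j <? j′
    ... | yes j<j′ = P₂-nonNeg (d j) (d j′) j<j′
    ... | no _     = ≤-refl

-- The mixed integer program

module Linearization {c ℓ₁ ℓ₂} (K : OrderedField c ℓ₁ ℓ₂) {n : ℕ}
                     (I : TSP.Instance K n) (L : TSP.Labelling K I) where
  open OrderedField K hiding (_≤_; refl; _*_; zero) renaming (sym to ≈-sym; trans to ≈-trans)
  open OrderedFieldProperties K
  open Optimization K
  open MILP
  open TSP K
  open Labelling L
  open Formulations I L
  open Matchings K I L
  open Cost K I L

  r : ℕ
  r = 2 * (q ∸ 1)

  eval-⨁ : ∀ {b r m} d p (e : Fin m → Affine b r) → eval d p (⨁ e) ≡ sum (λ j → eval d p (e j))
  eval-⨁ {m = zero}  d p e = refl
  eval-⨁ {m = suc m} d p e = cong (eval d p (e zero) +_) (eval-⨁ d p (e ∘ suc))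

  -- Repeats the local definition inside `M`, so that the constraints of `M` unfold definitionally
  -- to `constraintsFor`.
  ⨁above : Fin q → (Fin q → Affine q r) → Affine q r
  ⨁above j e = ⨁ λ j′ → if ⌊ j <? j′ ⌋ then e j′ else const 0#

  eval-⨁above : ∀ d p j e → eval d p (⨁above j e) ≈ above j (λ j′ → eval d p (e j′))
  eval-⨁above d p j e = ≈-trans
    (reflexive (eval-⨁ d p λ j′ → if ⌊ j <? j′ ⌋ then e j′ else const 0#))
    (sum-cong-≋ λ j′ → eval-if ⌊ j <? j′ ⌋ (e j′))
    where
    eval-if : ∀ b e → eval d p (if b then e else const 0#) ≈ (if b then eval d p e else 0#)
    eval-if true  e = refl≈
    eval-if false e = refl≈

  index : Bool → Fin (q ∸ 1) → Fin r
  index false j = combine {2} zero j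
  index true  j = combine {2} (suc zero) j

  -- The k-th inequality for j, at d_j = x and d_j′ = y, bounds p_j^{(k)} by the
  -- sum of the terms bound j j′ k x y over j′ > j.
  bound : Fin q → Fin q → Bool → Bool → Bool → Carrier
  bound j j′ false x y = P₂ j j′ false false · (1# - 0-1 x - 0-1 y) + P₂ j j′ false true · (0-1 y - 0-1 x)
  bound j j′ true  x y = P₂ j j′ true false · (0-1 x - 0-1 y) + P₂ j j′ true true · (0-1 x + 0-1 y - 1#)

  boundExpr : Fin q → Bool → Affine q r
  boundExpr j false = ⨁above j (λ j′ → P₂ j j′ false false ⊙ (const 1# ⊖ boolVar j ⊖ boolVar j′))
                    ⊕ ⨁above j (λ j′ → P₂ j j′ false true ⊙ (boolVar j′ ⊖ boolVar j))
  boundExpr j true  = ⨁above j (λ j′ → P₂ j j′ true false ⊙ (boolVar j ⊖ boolVar j′))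
                    ⊕ ⨁above j (λ j′ → P₂ j j′ true true ⊙ (boolVar j ⊕ boolVar j′ ⊖ const 1#))

  above-+ : ∀ j g h → above j g + above j h ≈ above j (λ j′ → g j′ + h j′)
  above-+ j g h = ≈-trans
    (≈-sym (∑-distrib-+ (λ j′ → if ⌊ j <? j′ ⌋ then g j′ else 0#) (λ j′ → if ⌊ j <? j′ ⌋ then h j′ else 0#)))
    (sum-cong-≋ λ j′ → if-+ ⌊ j <? j′ ⌋ (g j′) (h j′))

  eval-boundExpr : ∀ d p j k → eval d p (boundExpr j k) ≈ above j (λ j′ → bound j j′ k (d j) (d j′))
  eval-boundExpr d p j false =
    ≈-trans (+-cong (eval-⨁above d p j _) (eval-⨁above d p j _)) (above-+ j _ _)
  eval-boundExpr d p j true  =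
    ≈-trans (+-cong (eval-⨁above d p j _) (eval-⨁above d p j _)) (above-+ j _ _)

  private
    keepˡ : ∀ {a b s t} → s ≈ 1# → t ≈ 0# → a · s + b · t ≈ a
    keepˡ s≈1 t≈0 = ≈-trans (+-cong (·-≈1 _ s≈1) (·-≈0 _ t≈0)) (+-identityʳ _)

    keepʳ : ∀ {a b s t} → s ≈ 0# → t ≈ 1# → a · s + b · t ≈ b
    keepʳ s≈0 t≈1 = ≈-trans (+-cong (·-≈0 _ s≈0) (·-≈1 _ t≈1)) (+-identityˡ _)

    dropˡ : ∀ {a b s t} → 0# ≤ᴷ a → s ≈ - 1# → t ≈ 0# → a · s + b · t ≤ᴷ 0#
    dropˡ 0≤a s≈-1 t≈0 = +-nonPos (·-nonPos 0≤a s≈-1) (≤-reflexive (·-≈0 _ t≈0))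

    dropʳ : ∀ {a b s t} → 0# ≤ᴷ b → s ≈ 0# → t ≈ - 1# → a · s + b · t ≤ᴷ 0#
    dropʳ 0≤b s≈0 t≈-1 = +-nonPos (≤-reflexive (·-≈0 _ s≈0)) (·-nonPos 0≤b t≈-1)

    0-0 : 0# - 0# ≈ 0#
    0-0 = x-0≈x 0#

    1-1 : 1# - 1# ≈ 0#
    1-1 = -‿inverseʳ 1#

    0-1≈-1 : 0# - 1# ≈ - 1#
    0-1≈-1 = +-identityˡ (- 1#)

  -- For d_j = k the two linear coefficients take the values of the products in Q: 1 for the term
  -- selected by y and 0 for the other.
  bound-active : ∀ j j′ k y → bound j j′ k k y ≈ P₂ j j′ k y
  bound-active j j′ false false = keepˡ (≈-trans (x-0≈x _) (x-0≈x 1#)) 0-0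
  bound-active j j′ false true  = keepʳ (≈-trans (+-congʳ (x-0≈x 1#)) 1-1) (x-0≈x 1#)
  bound-active j j′ true  false = keepˡ (x-0≈x 1#) (≈-trans (+-congʳ (+-identityʳ 1#)) 1-1)
  bound-active j j′ true  true  = keepʳ 1-1
    (≈-trans (+-assoc 1# 1# (- 1#)) (≈-trans (+-congˡ 1-1) (+-identityʳ 1#)))

  -- For d_j different from k one coefficient is -1 and the other 0, which leaves the negative of
  -- some `P₂`.
  bound-inactive : ∀ {j j′} k y → j < j′ → bound j j′ k (not k) y ≤ᴷ 0#
  bound-inactive false false j<j′ = dropʳ (P₂-nonNeg false true j<j′) (≈-trans (x-0≈x _) 1-1) 0-1≈-1
  bound-inactive false true  j<j′ = dropˡ (P₂-nonNeg false false j<j′)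
    (≈-trans (+-congʳ 1-1) 0-1≈-1) 1-1
  bound-inactive true  false j<j′ = dropʳ (P₂-nonNeg true true j<j′) 0-0
    (≈-trans (+-congʳ (+-identityʳ 0#)) 0-1≈-1)
  bound-inactive true  true  j<j′ = dropˡ (P₂-nonNeg true false j<j′) 0-1≈-1
    (≈-trans (+-congʳ (+-identityˡ 1#)) 1-1)

  Bound : (Fin q → Bool) → Fin q → Bool → Carrier
  Bound d j k = above j λ j′ → bound j j′ k (d j) (d j′)

  Bound-active : ∀ d j → Bound d j (d j) ≈ cross d j
  Bound-active d j = above-cong j λ j′ → bound-active j j′ (d j) (d j′)

  Bound-inactive : ∀ d j k → d j ≡ not k → Bound d j k ≤ᴷ 0#
  Bound-inactive d j k dj≡ rewrite dj≡ = sum-nonPos nonPos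
    where
    nonPos : ∀ j′ → (if ⌊ j <? j′ ⌋ then bound j j′ k (not k) (d j′) else 0#) ≤ᴷ 0#
    nonPos j′ with j <? j′
    ... | yes j<j′ = bound-inactive k (d j′) j<j′
    ... | no _     = ≤-refl

  record Satisfies (d : Fin q → Bool) (p : Fin r → Carrier) : Set ℓ₂ where
    field
      nonNeg  : ∀ k j₀ → 0# ≤ᴷ p (index k j₀)
      bounded : ∀ k j₀ → Bound d (below j₀) k ≤ᴷ p (index k j₀)

  constraintsFor : Fin (q ∸ 1) → List (Constraint q r)
  constraintsFor j₀ = (realVar (index false j₀) ⊵ const 0#)
                    ∷ (realVar (index true j₀) ⊵ const 0#)
                    ∷ (realVar (index false j₀) ⊵ boundExpr (below j₀) false)
                    ∷ (realVar (index true j₀) ⊵ boundExpr (below j₀) true)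
                    ∷ []

  feasible⇒satisfies : ∀ {d p} → All (Holds d p) (constraints M) → Satisfies d p
  feasible⇒satisfies {d} {p} all = record { nonNeg = nonNeg ; bounded = bounded }
    where
    at : ∀ j₀ → All (Holds d p) (constraintsFor j₀)
    at = tabulate⁻ (map⁻ (concat⁻ all))

    nonNeg : ∀ k j₀ → 0# ≤ᴷ p (index k j₀)
    nonNeg false j₀ with at j₀
    ... | c ∷ _ = c
    nonNeg true  j₀ with at j₀
    ... | _ ∷ c ∷ _ = c

    bounded : ∀ k j₀ → Bound d (below j₀) k ≤ᴷ p (index k j₀)
    bounded false j₀ with at j₀
    ... | _ ∷ _ ∷ c ∷ _ = ≤-trans (≤-reflexive (≈-sym (eval-boundExpr d p (below j₀) false))) c
    bounded true  j₀ with at j₀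
    ... | _ ∷ _ ∷ _ ∷ c ∷ _ = ≤-trans (≤-reflexive (≈-sym (eval-boundExpr d p (below j₀) true))) c

  satisfies⇒feasible : ∀ {d p} → Satisfies d p → All (Holds d p) (constraints M)
  satisfies⇒feasible {d} {p} sat = concat⁺ (map⁺ (tabulate⁺ at))
    where
    open Satisfies sat

    at : ∀ j₀ → All (Holds d p) (constraintsFor j₀)
    at j₀ = nonNeg false j₀
          ∷ nonNeg true j₀
          ∷ ≤-trans (≤-reflexive (eval-boundExpr d p (below j₀) false)) (bounded false j₀)
          ∷ ≤-trans (≤-reflexive (eval-boundExpr d p (below j₀) true)) (bounded true j₀)
          ∷ []

  cost : (Fin q → Bool) → (Fin r → Carrier) → Carrier
  cost d p = Minimization.objective (minimization M) (d , p)

  cost≈ : ∀ d p → cost d p ≈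
    sum (λ j₀ → p (index false j₀) + p (index true j₀)) + sum (λ j → P₁ j (d j))
  cost≈ d p = +-cong (reflexive (eval-⨁ d p (λ j₀ → realVar (index false j₀) ⊕ realVar (index true j₀))))
    (≈-trans
      (reflexive (eval-⨁ d p (λ j →
        P₁ j false ⊙ (const 1# ⊖ boolVar j) ⊕ P₁ j true ⊙ boolVar j)))
      (linear≈ d))

  -- Of the two real variables of j, the one with k = d_j already pays for `cross d j`, and the
  -- other is nonnegative.
  satisfies⇒chosen≤cost : ∀ {d p} → Satisfies d p → chosen d ≤ᴷ cost d p
  satisfies⇒chosen≤cost {d} {p} sat = ≤-trans
    (+-mono-≤ (≤-trans (≤-reflexive (≈-sym (sum-above λ j j′ → P₂ j j′ (d j) (d j′)))) (sum-mono-≤ at)) ≤-refl)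
    (≤-reflexive (≈-sym (cost≈ d p)))
    where
    open Satisfies sat

    at : ∀ j₀ → cross d (below j₀) ≤ᴷ p (index false j₀) + p (index true j₀)
    at j₀ = ≤-trans (≤-reflexive (≈-sym (Bound-active d (below j₀)))) (active (d (below j₀)))
      where
      active : ∀ k → Bound d (below j₀) k ≤ᴷ p (index false j₀) + p (index true j₀)
      active false = ≤-trans (≤-reflexive (≈-sym (+-identityʳ _))) (+-mono-≤ (bounded false j₀) (nonNeg true j₀))
      active true  = ≤-trans (≤-reflexive (≈-sym (+-identityˡ _))) (+-mono-≤ (nonNeg false j₀) (bounded true j₀))

  -- The cheapest real variables for given d: with x = d_j, the whole amount v goes to k = d_j and
  -- nothing to the other.
  level : Bool → Bool → Carrier → Carrier
  level false false v = v
  level false true  v = 0#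
  level true  false v = 0#
  level true  true  v = v

  level-nonNeg : ∀ x k {v} → 0# ≤ᴷ v → 0# ≤ᴷ level x k v
  level-nonNeg false false 0≤v = 0≤v
  level-nonNeg false true  0≤v = ≤-refl
  level-nonNeg true  false 0≤v = ≤-refl
  level-nonNeg true  true  0≤v = 0≤v

  level-sum : ∀ x v → level x false v + level x true v ≈ v
  level-sum false v = +-identityʳ v
  level-sum true  v = +-identityˡ v

  Bound≤level : ∀ d j x k → d j ≡ x → Bound d j k ≤ᴷ level x k (cross d j)
  Bound≤level d j false false dj≡ =
    ≤-reflexive (subst (λ k → Bound d j k ≈ cross d j) dj≡ (Bound-active d j))
  Bound≤level d j false true  dj≡ = Bound-inactive d j true dj≡
  Bound≤level d j true  false dj≡ = Bound-inactive d j false dj≡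
  Bound≤level d j true  true  dj≡ =
    ≤-reflexive (subst (λ k → Bound d j k ≈ cross d j) dj≡ (Bound-active d j))

  levels : (Fin q → Bool) → Fin r → Carrier
  -- `remQuot` inverts the `combine` in `index`, recovering k and j from the flat variable number.
  levels d v with remQuot {2} (q ∸ 1) v
  ... | zero  , j₀ = level (d (below j₀)) false (cross d (below j₀))
  ... | suc _ , j₀ = level (d (below j₀)) true (cross d (below j₀))

  levels-index : ∀ d k j₀ → levels d (index k j₀) ≡ level (d (below j₀)) k (cross d (below j₀))
  levels-index d false j₀ rewrite remQuot-combine {2} {q ∸ 1} zero j₀ = refl
  levels-index d true  j₀ rewrite remQuot-combine {2} {q ∸ 1} (suc zero) j₀ = refl

  levels-satisfy : ∀ d → Satisfies d (levels d)
  levels-satisfy d = record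
    { nonNeg  = λ k j₀ → let j = below j₀ in
        subst (0# ≤ᴷ_) (≡.sym (levels-index d k j₀)) (level-nonNeg (d j) k (cross-nonNeg d j))
    ; bounded = λ k j₀ → let j = below j₀ in
        subst (Bound d j k ≤ᴷ_) (≡.sym (levels-index d k j₀)) (Bound≤level d j (d j) k refl)
    }

  cost-levels : ∀ d → cost d (levels d) ≈ chosen d
  cost-levels d = ≈-trans (cost≈ d (levels d)) (+-congʳ (≈-trans
    (sum-cong-≋ λ j₀ → ≈-trans
      (reflexive (cong₂ _+_ (levels-index d false j₀) (levels-index d true j₀)))
      (level-sum (d (below j₀)) (cross d (below j₀))))
    (sum-above λ j j′ → P₂ j j′ (d j) (d j′))))

  length-constraints : length (constraints M) ≡ (q ∸ 1) * 4
  length-constraints = ≡.trans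
    (length-concatMap constraintsFor (λ _ → refl) (allFin (q ∸ 1)))
    (cong (_* 4) (length-tabulate {n = q ∸ 1} id))
    where
    length-concatMap : ∀ {a b} {A : Set a} {B : Set b} {m} (f : A → List B) → (∀ x → length (f x) ≡ m) →
                       ∀ xs → length (concatMap f xs) ≡ length xs * m
    length-concatMap f len []       = refl
    length-concatMap f len (x ∷ xs) = ≡.trans (length-++ (f x))
      (cong₂ ℕ._+_ (len x) (length-concatMap f len xs))

-- Transfer of optimality between the three problems

module EquivalentFormulations {c ℓ₁ ℓ₂} (K : OrderedField c ℓ₁ ℓ₂) {n : ℕ}
    (I : TSP.Instance K n) (feasible : TSP.FeasibleInstance K I) (L : TSP.Labelling K I) where
  open OrderedField K hiding (_≤_; refl; _*_; zero) renaming (sym to ≈-sym; trans to ≈-trans)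
  open OrderedFieldProperties K
  open Optimization K
  open Minimization
  open MILP
  open TSP K
  open Labelling L
  open Formulations I L
  open Matchings K I L
  open Cost K I L
  open Linearization K I L

  Minimal : (Fin q → Bool) → Set ℓ₂
  Minimal d = ∀ e → chosen d ≤ᴷ chosen e

  minimal⇒Q : ∀ {d} → Minimal d → IsOptimal Q d
  minimal⇒Q {d} min = tt , λ e _ →
    ≤-trans (≤-reflexive (Q≈chosen d)) (≤-trans (min e) (≤-reflexive (≈-sym (Q≈chosen e))))

  Q⇒minimal : ∀ {d} → IsOptimal Q d → Minimal d
  Q⇒minimal {d} (_ , min) e =
    ≤-trans (≤-reflexive (≈-sym (Q≈chosen d))) (≤-trans (min e tt) (≤-reflexive (Q≈chosen e)))

  minimal⇒M : ∀ {d} → Minimal d → IsOptimal (minimization M) (d , levels d)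
  minimal⇒M {d} min = satisfies⇒feasible (levels-satisfy d) , λ (e , p) holds →
    ≤-trans (≤-reflexive (cost-levels d))
      (≤-trans (min e) (satisfies⇒chosen≤cost (feasible⇒satisfies holds)))

  M⇒minimal : ∀ {d p} → IsOptimal (minimization M) (d , p) → Minimal d
  M⇒minimal {d} (holds , min) e =
    ≤-trans (satisfies⇒chosen≤cost (feasible⇒satisfies holds))
      (≤-trans (min (e , levels e) (satisfies⇒feasible (levels-satisfy e)))
        (≤-reflexive (cost-levels e)))

  minimal⇒TSPVR : ∀ {d} → Minimal d → IsOptimal (TSPVR I) (tour d)
  minimal⇒TSPVR {d} min = isTour (proj₂ feasible) d , λ f f-tour →
    let e , f≗ = tour-complete f-tour in
    ≤-trans (≤-reflexive (tourCost≈chosen+fixed d))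
      (≤-trans (+-monoˡ-≤ fixed (min e))
        (≤-reflexive (≈-sym (≈-trans (tourCost-cong f≗) (tourCost≈chosen+fixed e)))))

  TSPVR⇒minimal : ∀ {d} → IsOptimal (TSPVR I) (tour d) → Minimal d
  TSPVR⇒minimal {d} (_ , min) e = +-cancelʳ-≤ fixed
    (≤-trans (≤-reflexive (≈-sym (tourCost≈chosen+fixed d)))
      (≤-trans (min (tour e) (isTour (proj₂ feasible) e))
        (≤-reflexive (tourCost≈chosen+fixed e))))

  -- An optimum of M exists although its real variables range over an infinite set: the search runs
  -- over the finitely many d only, and `levels` supplies the real part.
  common-optimal-value : ∃ λ v → IsOptimalValue Q v × IsOptimalValue (minimization M) v
  common-optimal-value =
    let d , min = argmin q chosen chosen-cong in
    chosen d , (d , minimal⇒Q min , Q≈chosen d) , ((d , levels d) , minimal⇒M min , cost-levels d)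

mainTheorem4 : ∀ {c ℓ₁ ℓ₂} (K : OrderedField c ℓ₁ ℓ₂) →
  let open Optimization K
      open Minimization
      open MILP
      open TSP K in
  ∃ λ (C : ℕ) → (n : ℕ) → 2 ≤ n → (I : Instance n) → FeasibleInstance I → (L : Labelling I) →
  let open Labelling L using (q)
      open Formulations I L in
    (∃ λ v → IsOptimalValue Q v × IsOptimalValue (minimization M) v)
  × (∀ d p → IsOptimal (minimization M) (d , p) → IsOptimal Q d)
  × (∀ d → IsOptimal Q d → ∃ λ p → IsOptimal (minimization M) (d , p))
  × (∀ d → IsOptimal Q d ⇔ IsOptimal (TSPVR I) (tour d))
  × (#Bool M ≡ q × q ≤ ⌊ n /2⌋)
  × (1 ≤ q → #Real M ≡ 2 * q ∸ 2)
  × (length (constraints M) ≤ C * q)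
-- The constant is 4 because each of the q ∸ 1 indices carries four constraints.
mainTheorem4 K = 4 , λ n 2≤n I feasible L →
  let open TSP.Labelling L using (q)
      open TSP.Formulations K I L using (tour)
      open Matchings K I L using (q≤⌊n/2⌋)
      open Linearization K I L using (levels; length-constraints)
      open EquivalentFormulations K I feasible L
  in common-optimal-value
   , (λ d p opt → minimal⇒Q (M⇒minimal opt))
   , (λ d opt → levels d , minimal⇒M (Q⇒minimal opt))
   , (λ d → mk⇔ (λ opt → minimal⇒TSPVR (Q⇒minimal opt)) (λ opt → minimal⇒Q (TSPVR⇒minimal opt)))
   , (refl , q≤⌊n/2⌋)
   , (λ _ → ℕₚ.*-distribˡ-∸ 2 q 1)
   , ℕₚ.≤-trans (ℕₚ.≤-reflexive (≡.trans length-constraints (ℕₚ.*-comm (q ∸ 1) 4)))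
                (ℕₚ.*-monoʳ-≤ 4 (ℕₚ.m∸n≤m q 1))
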